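{- Let $n\ge 1$ be an integer and let $x,y$ be complex numbers such that no denominator below vanishes, i.e. $x\notin\{ -1,\dots,-n\}$, $x-y\notin\{ -1,\dots,-n\}$ and $y\notin\{ -n,-n+1,\dots,n-1\}$. Then $$\sum_{k=0}^n(-1)^k\binom{n}{k}\frac{\binom{y+k}{k}}{\binom{y-n+k}{k}}\frac{y}{y+k}H_{k}^{\langle2\rangle}(x)=\frac{(-1)^n}{n}\,\frac{\binom{x-y+n}{n}}{\binom{x+n}{n}\binom{y}{n}}\Big\{H_{n}(x-y)-H_{n}(x)\Big\}.$$
   Context: For a complex number $u$ and an integer $k\ge 0$, $\binom{u}{k}=\frac{u(u-1)\cdots(u-k+1)}{k!}$ (equal to $1$ for $k=0$). For a complex number $u$ and a positive integer $\ell$, the generalized harmonic numbers of $\ell$-order are $H_0^{\langle\ell\rangle}(u)=0$ and $H_n^{\langle\ell\rangle}(u)=\sum_{k=1}^n\frac{1}{(u+k)^\ell}$ for $n\ge1$; $H_n(u)=H_n^{\langle1\rangle}(u)$. -}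

module Defs where

open import Algebra.Apartness.Bundles using (HeytingCommutativeRing; HeytingField)
open import Algebra.Bundles using (CommutativeRing; Semiring)
open import Data.Fin.Base using (Fin; zero; suc; toℕ)
open import Data.Fin.Properties using (toℕ<n)
open import Data.Integer.Base as ℤ using (ℤ; +_; -[1+_]; -1ℤ; +≤+; -≤-; -≤+)
import Data.Integer.Properties as ℤ
open import Data.Nat.Base as ℕ using (ℕ; zero; suc; NonZero; _!; z≤n; s≤s)
import Data.Nat.Properties as ℕ
open import Data.Product.Base using (_,_; proj₁)
open import Data.Vec.Functional using (Vector)
open import Level using (Level)
import Relation.Binary.PropositionalEquality as ≡
import Algebra.Apartness.Properties.HeytingCommutativeRing as HeytingProperties
import Algebra.Definitions.RawSemiring as RawSemiringDefinitions
import Algebra.Properties.CommutativeMonoid.Sum as SumProperties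
import Algebra.Properties.Ring as RingProperties
import Algebra.Properties.Semiring.Mult as MultProperties
import Relation.Binary.Reasoning.Setoid as SetoidReasoning

private variable
  c ℓ₁ ℓ₂ : Level

-- The complex numbers are replaced by an arbitrary Heyting field of
-- characteristic zero; "a denominator does not vanish" is then `d # 0#`.
-- Taking `_#_` to be `¬ (_ ≈ _)` gives the usual classical reading.

module FieldOperations (F : HeytingField c ℓ₁ ℓ₂) where

  open HeytingField F public hiding (zero)

  open HeytingCommutativeRing heytingCommutativeRing public
    using (commutativeRing)
  open CommutativeRing commutativeRing public
    using (semiring; ring; +-commutativeMonoid)
  open Semiring semiring public using (rawSemiring)
  open RawSemiringDefinitions rawSemiring public using (_^_; _×_; product)
  open SumProperties +-commutativeMonoid public
    using (sum; sum-syntax; sum⁺-syntax)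
  open HeytingProperties heytingCommutativeRing public
  open RingProperties ring using (-0#≈0#; -‿+-comm; -‿involutive)
  open MultProperties semiring using (×-homo-+)

  ι : ℕ → Carrier
  ι k = k × 1#

  fromℤ : ℤ → Carrier
  fromℤ (+ k)    = ι k
  fromℤ -[1+ k ] = - ι (suc k)

  CharacteristicZero : Set ℓ₂
  CharacteristicZero = ∀ n → .{{NonZero n}} → ι n # 0#

  -- u ∉ {a, a + 1, …, b}
  infix 4 _∉[_,_]
  _∉[_,_] : Carrier → ℤ → ℤ → Set ℓ₂
  u ∉[ a , b ] = ∀ j → a ℤ.≤ j → j ℤ.≤ b → u # fromℤ j

  -- `#⇒invertible b#0` inverts `b - 0#`, which is `≈ b`.
  infixl 7 _/_[_]
  _/_[_] : (a b : Carrier) → b # 0# → Carrier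
  a / b [ b#0 ] = a * proj₁ (#⇒invertible b#0)

  product#0 : ∀ {n} (f : Vector Carrier n) → (∀ i → f i # 0#) → product f # 0#
  product#0 {zero}  f f#0 = 1#0
  product#0 {suc n} f f#0 =
    x#0y#0→xy#0 (f#0 zero) (product#0 (λ i → f (suc i)) (λ i → f#0 (suc i)))

  ^#0 : ∀ {u} ℓ → u # 0# → u ^ ℓ # 0#
  ^#0 zero    u#0 = 1#0
  ^#0 (suc ℓ) u#0 = x#0y#0→xy#0 u#0 (^#0 ℓ u#0)

  #⇒-#0 : ∀ {u v} → u # v → u - v # 0#
  #⇒-#0 {u} {v} u#v with #⇒invertible u#v
  ... | w , w*[u-v]≈1 , _ = invertibleˡ⇒#
    (w , trans (*-congˡ (x-0≈x (u - v))) w*[u-v]≈1)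

  ι-+ : ∀ m k → ι (m ℕ.+ k) ≈ ι m + ι k
  ι-+ m k = ×-homo-+ 1# m k

  fromℤ-neg : ∀ k → fromℤ (ℤ.- + k) ≈ - ι k
  fromℤ-neg zero    = sym -0#≈0#
  fromℤ-neg (suc k) = refl

  ∉-mono : ∀ {u k n} → k ℕ.≤ n →
           u ∉[ ℤ.- + n , -1ℤ ] → u ∉[ ℤ.- + k , -1ℤ ]
  ∉-mono k≤n u∉ j -k≤j = u∉ j (ℤ.≤-trans (ℤ.neg-mono-≤ (+≤+ k≤n)) -k≤j)

  +ι#0 : ∀ {u a b} k → u ∉[ a , b ] →
         a ℤ.≤ ℤ.- + k → ℤ.- + k ℤ.≤ b → u + ι k # 0#
  +ι#0 k u∉ a≤ ≤b = #-congʳ (+-congˡ eq) (#⇒-#0 (u∉ (ℤ.- + k) a≤ ≤b))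
    where
    eq : - fromℤ (ℤ.- + k) ≈ ι k
    eq = trans (-‿cong (fromℤ-neg k)) (-‿involutive (ι k))

  u+k#0 : ∀ {u n} → u ∉[ ℤ.- + n , -1ℤ ] → ∀ (i : Fin n) →
          u + ι (suc (toℕ i)) # 0#
  u+k#0 u∉ i = +ι#0 (suc (toℕ i)) u∉ (ℤ.neg-mono-≤ (+≤+ (toℕ<n i))) (-≤- z≤n)

  +-∸-cancel : ∀ u {m k} → k ℕ.≤ m → u + ι m - ι k ≈ u + ι (m ℕ.∸ k)
  +-∸-cancel u {m} {k} k≤m = begin
    u + ι m - ι k                   ≡⟨ ≡.cong (λ t → u + ι t - ι k) (ℕ.m∸n+n≡m k≤m) ⟨
    u + ι (m ℕ.∸ k ℕ.+ k) - ι k     ≈⟨ +-congʳ (+-congˡ (ι-+ (m ℕ.∸ k) k)) ⟩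
    u + (ι (m ℕ.∸ k) + ι k) - ι k   ≈⟨ +-congʳ (+-assoc u _ _) ⟨
    u + ι (m ℕ.∸ k) + ι k - ι k     ≈⟨ +-assoc _ (ι k) (- ι k) ⟩
    u + ι (m ℕ.∸ k) + (ι k - ι k)   ≈⟨ +-congˡ (-‿inverseʳ (ι k)) ⟩
    u + ι (m ℕ.∸ k) + 0#            ≈⟨ +-identityʳ _ ⟩
    u + ι (m ℕ.∸ k)                 ∎
    where open SetoidReasoning setoid

  -ι+ι : ∀ u {m k} → k ℕ.≤ m → u - ι m + ι k ≈ u - ι (m ℕ.∸ k)
  -ι+ι u {m} {k} k≤m = begin
    u - ι m + ι k                         ≡⟨ ≡.cong (λ t → u - ι t + ι k) (ℕ.m∸n+n≡m k≤m) ⟨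
    u - ι (m ℕ.∸ k ℕ.+ k) + ι k           ≈⟨ +-congʳ (+-congˡ (-‿cong (ι-+ (m ℕ.∸ k) k))) ⟩
    u - (ι (m ℕ.∸ k) + ι k) + ι k         ≈⟨ +-congʳ (+-congˡ (-‿+-comm _ _)) ⟨
    u + (- ι (m ℕ.∸ k) - ι k) + ι k       ≈⟨ +-congʳ (+-assoc u _ _) ⟨
    u - ι (m ℕ.∸ k) - ι k + ι k           ≈⟨ +-assoc _ (- ι k) (ι k) ⟩
    u - ι (m ℕ.∸ k) + (- ι k + ι k)       ≈⟨ +-congˡ (-‿inverseˡ (ι k)) ⟩
    u - ι (m ℕ.∸ k) + 0#                  ≈⟨ +-identityʳ _ ⟩
    u - ι (m ℕ.∸ k)                       ∎
    where open SetoidReasoning setoid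

  H⟨_⟩ : ∀ (ℓ n : ℕ) (u : Carrier) → u ∉[ ℤ.- + n , -1ℤ ] → Carrier
  H⟨ ℓ ⟩ n u u∉ =
    ∑[ i < n ] (1# / (u + ι (suc (toℕ i))) ^ ℓ [ ^#0 ℓ (u+k#0 u∉ i) ])

  H : ∀ (n : ℕ) (u : Carrier) → u ∉[ ℤ.- + n , -1ℤ ] → Carrier
  H = H⟨ 1 ⟩

  module Binomial (char0 : CharacteristicZero) where

    binom : Carrier → ℕ → Carrier
    binom u k =
      product {k} (λ i → u - ι (toℕ i)) / ι (k !) [ char0 (k !) {{k ℕ.!≢0}} ]

    binom#0 : ∀ u k → (∀ (i : Fin k) → u - ι (toℕ i) # 0#) → binom u k # 0#
    binom#0 u k u-i#0 = x#0y#0→xy#0 (product#0 {k} _ u-i#0) inverse#0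
      where
      k!#0 = char0 (k !) {{k ℕ.!≢0}}
      inverse#0 : proj₁ (#⇒invertible k!#0) # 0#
      inverse#0 with #⇒invertible k!#0
      ... | w , _ , [k!-0]*w≈1 = invertibleˡ⇒#
        (ι (k !) - 0# , trans (*-congˡ (x-0≈x w)) [k!-0]*w≈1)

    binom[u+n,n]#0 : ∀ {u n} → u ∉[ ℤ.- + n , -1ℤ ] → binom (u + ι n) n # 0#
    binom[u+n,n]#0 {u} {n} u∉ = binom#0 (u + ι n) n λ i →
      let i<n = toℕ<n i in
      #-congʳ (sym (+-∸-cancel u (ℕ.<⇒≤ i<n)))
        (+ι#0 (n ℕ.∸ toℕ i) u∉
          (ℤ.neg-mono-≤ (+≤+ (ℕ.m∸n≤m n (toℕ i))))
          (ℤ.neg-mono-≤ (+≤+ (ℕ.m<n⇒0<n∸m i<n))))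

    module _ {y n} (y∉ : y ∉[ ℤ.- + n , + n ℤ.- + 1 ]) where

      y-m#0 : ∀ {m} → m ℕ.< n → y - ι m # 0#
      y-m#0 {m} m<n = #⇒-#0 (y∉ (+ m) ℤ.neg-≤-pos
        (ℤ.≤-trans (+≤+ (ℕ.<⇒≤pred m<n)) (ℤ.≤-reflexive (pred≡ m<n))))
        where
        pred≡ : ∀ {m n} → m ℕ.< n → + ℕ.pred n ≡.≡ + n ℤ.- + 1
        pred≡ (s≤s _) = ≡.refl

      y+k#0 : .{{NonZero n}} → ∀ {k} → k ℕ.≤ n → y + ι k # 0#
      y+k#0 {k} k≤n = +ι#0 k y∉ (ℤ.neg-mono-≤ (+≤+ k≤n))
        (ℤ.≤-trans (ℤ.neg-≤-pos {k} {0})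
          (ℤ.i≤j⇒0≤j-i (+≤+ (ℕ.>-nonZero⁻¹ n))))

      binom[y,n]#0 : binom y n # 0#
      binom[y,n]#0 = binom#0 y n λ i → y-m#0 (toℕ<n i)

      binom[y-n+k,k]#0 : ∀ {k} → k ℕ.≤ n → binom (y - ι n + ι k) k # 0#
      binom[y-n+k,k]#0 {k} k≤n = binom#0 (y - ι n + ι k) k λ i →
        let d   = k ℕ.∸ toℕ i
            d≤n = ℕ.≤-trans (ℕ.m∸n≤m k (toℕ i)) k≤n
            0<d = ℕ.m<n⇒0<n∸m (toℕ<n i)
        in #-congʳ
             (sym (trans (+-∸-cancel (y - ι n) (ℕ.<⇒≤ (toℕ<n i))) (-ι+ι y d≤n)))
             (y-m#0 (ℕ.∸-monoʳ-< 0<d d≤n))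

{-# OPTIONS --safe #-}
module Submission where

-- Write u^{(n)} for the falling factorial and ∇ for the alternating binomial
-- sum f ↦ ∑ (-1)^k C(m,k) f k.  After multiplication by y^{(n)} the left-hand
-- side is y ∑ (-1)^k C(n,k) (y+k-1)^{(n-1)} H_k, and a summation by parts turns
-- it into -∑ (-1)^k C(n-1,k) (y+k)^{(n)} / (x+k+1)².  The last sum is, up to a
-- constant, the derivative in x of the partial fraction expansion of
-- R(x) = ∏ (x-y+j)/(x+j), so it is a multiple of R(x) (H_n(x-y) - H_n(x)).
-- No derivative is taken: both the expansion and its derived form satisfy a
-- Pascal-type recursion in n, along which they are proved together.

open import Defs
open import Algebra.Apartness.Bundles using (HeytingField)
open import Algebra.Bundles using (CommutativeRing; RawRing)
import Algebra.Properties.CommutativeMonoid.Sum as SumProperties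
import Algebra.Properties.Ring as RingProperties
import Algebra.Properties.Semiring.Exp as ExpProperties
import Algebra.Properties.Semiring.Mult as MultProperties
import Algebra.Properties.Semiring.Sum as SemiringSumProperties
open import Algebra.Solver.Ring.AlmostCommutativeRing
  using (AlmostCommutativeRing; _-Raw-AlmostCommutative⟶_)
import Algebra.Solver.Ring as RingSolver
open import Data.Fin.Base using (Fin; zero; suc; toℕ; fromℕ; inject₁)
open import Data.Fin.Properties using (∀-cons; toℕ<n; toℕ≤pred[n]; toℕ-inject₁; toℕ-fromℕ)
open import Data.Integer.Base as ℤ using (+_; -1ℤ)
open import Data.Maybe.Base using (Maybe; just; nothing)
open import Data.Nat.Base as ℕ using (ℕ; zero; suc; NonZero; _!)
import Data.Nat.Properties as ℕ
open import Data.Product.Base as Product using (_,_; proj₁; proj₂)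
open import Data.Vec.Functional using (Vector; init; last; tail; head)
open import Function.Base using (_∘_)
open import Level using (Level)
import Relation.Binary.PropositionalEquality as ≡
import Relation.Binary.Reasoning.Setoid as SetoidReasoning
open import Relation.Nullary.Decidable using (yes; no)

-- The second-order harmonic numbers enter only through their increments 1/(x+k+1)², which are minus
-- the x-derivatives of 1/(x+k+1). The difference on the right is the logarithmic derivative of R,
-- with y held fixed. The recursion has to keep y fixed as well. From n to n+1, Pascal's rule yields
-- an unshifted and a shifted half, and the shift would naturally move x and y together. But the
-- shifted numerator (y+k+1)^{(n+1)} begins with y+k+1, and removing that factor leaves (y+k)^{(n)},
-- just as removing the last factor does in the unshifted half. So both halves have the same
-- numerators and differ only in x, which becomes x+1. Hence sums of bare numerators cancel without
-- being evaluated, and R loses its last factor in one half and its first in the other.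

private variable
  c ℓ ℓ₁ ℓ₂ : Level

-- A ring solver with integer coefficients.

-- Integer coefficients let the ring solver cancel x - x; the pair (a , b)
-- stands for a - b.

module IntegerSolver (R : CommutativeRing c ℓ) where

  open CommutativeRing R
  open RingProperties ring
  open MultProperties semiring
  open SetoidReasoning setoid

  private
    Coefficient : Set
    Coefficient = ℕ Product.× ℕ

    coefficients : RawRing _ _
    coefficients = record
      { Carrier = Coefficient
      ; _≈_     = ≡._≡_
      ; _+_     = λ (a , b) (a′ , b′) → a ℕ.+ a′ , b ℕ.+ b′
      ; _*_     = λ (a , b) (a′ , b′) →
                    a ℕ.* a′ ℕ.+ b ℕ.* b′ , a ℕ.* b′ ℕ.+ b ℕ.* a′
      ; -_      = λ (a , b) → b , a
      ; 0#      = 0 , 0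
      ; 1#      = 1 , 0
      }

    open RawRing coefficients using ()
      renaming (_+_ to _+ᶜ_; _*_ to _*ᶜ_; -_ to -ᶜ_)

    ι : ℕ → Carrier
    ι k = k × 1#

    difference : Coefficient → Carrier
    difference (a , b) = ι a - ι b

    -- Equal to `difference`, but definitionally 0# and 1# on the constants, so
    -- that `con` matches goals containing them.
    value : Coefficient → Carrier
    value (0 , 0) = 0#
    value (1 , 0) = 1#
    value p       = difference p

    value≈ : ∀ p → value p ≈ difference p
    value≈ (0 , 0)           = sym (-‿inverseʳ 0#)
    value≈ (1 , 0)           = sym (trans (+-cong (+-identityʳ 1#) -0#≈0#) (+-identityʳ 1#))
    value≈ (suc (suc a) , 0) = refl
    value≈ (0 , suc b)           = refl
    value≈ (1 , suc b)           = refl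
    value≈ (suc (suc a) , suc b) = refl

    +-interchange : ∀ p q r s → (p + q) + (r + s) ≈ (p + r) + (q + s)
    +-interchange p q r s = begin
      (p + q) + (r + s)  ≈⟨ +-assoc p q (r + s) ⟩
      p + (q + (r + s))  ≈⟨ +-congˡ (+-assoc q r s) ⟨
      p + ((q + r) + s)  ≈⟨ +-congˡ (+-congʳ (+-comm q r)) ⟩
      p + ((r + q) + s)  ≈⟨ +-congˡ (+-assoc r q s) ⟩
      p + (r + (q + s))  ≈⟨ +-assoc p r (q + s) ⟨
      (p + r) + (q + s)  ∎

    difference-+ : ∀ p q → difference (p +ᶜ q) ≈ difference p + difference q
    difference-+ (a , b) (a′ , b′) = begin
      ι (a ℕ.+ a′) - ι (b ℕ.+ b′)        ≈⟨ +-cong (×-homo-+ 1# a a′) (-‿cong (×-homo-+ 1# b b′)) ⟩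
      (ι a + ι a′) - (ι b + ι b′)        ≈⟨ +-congˡ (-‿+-comm (ι b) (ι b′)) ⟨
      (ι a + ι a′) + (- ι b + - ι b′)    ≈⟨ +-interchange _ _ _ _ ⟩
      (ι a - ι b) + (ι a′ - ι b′)        ∎

    ι-sum-of-products : ∀ a b a′ b′ →
      ι (a ℕ.* a′ ℕ.+ b ℕ.* b′) ≈ ι a * ι a′ + ι b * ι b′
    ι-sum-of-products a b a′ b′ =
      trans (×-homo-+ 1# (a ℕ.* a′) (b ℕ.* b′)) (+-cong (×1-homo-* a a′) (×1-homo-* b b′))

    difference-* : ∀ p q → difference (p *ᶜ q) ≈ difference p * difference q
    difference-* (a , b) (a′ , b′) = begin
      ι (a ℕ.* a′ ℕ.+ b ℕ.* b′) - ι (a ℕ.* b′ ℕ.+ b ℕ.* a′)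
        ≈⟨ +-cong (ι-sum-of-products a b a′ b′) (-‿cong (ι-sum-of-products a b b′ a′)) ⟩
      (A * A′ + B * B′) - (A * B′ + B * A′)
        ≈⟨ +-congˡ (-‿cong (+-comm _ _)) ⟩
      (A * A′ + B * B′) - (B * A′ + A * B′)
        ≈⟨ +-congˡ (-‿+-comm _ _) ⟨
      (A * A′ + B * B′) + (- (B * A′) + - (A * B′))
        ≈⟨ +-interchange _ _ _ _ ⟩
      (A * A′ - B * A′) + (B * B′ - A * B′)
        ≈⟨ +-cong ([y-z]x≈yx-zx A′ A B) ([y-z]x≈yx-zx B′ B A) ⟨
      (A - B) * A′ + (B - A) * B′
        ≈⟨ +-congˡ (*-congʳ (⁻¹-anti-homo‿- A B)) ⟨
      (A - B) * A′ + - (A - B) * B′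
        ≈⟨ +-congˡ (-‿distribˡ-* (A - B) B′) ⟨
      (A - B) * A′ - (A - B) * B′
        ≈⟨ x[y-z]≈xy-xz (A - B) A′ B′ ⟨
      (A - B) * (A′ - B′)
        ∎
      where
      A = ι a; B = ι b; A′ = ι a′; B′ = ι b′

    almostCommutativeRing : AlmostCommutativeRing _ _
    almostCommutativeRing = record
      { isAlmostCommutativeRing = record
        { isCommutativeSemiring = isCommutativeSemiring
        ; -‿cong      = -‿cong
        ; -‿*-distribˡ = λ x y → sym (-‿distribˡ-* x y)
        ; -‿+-comm    = -‿+-comm
        }
      }

    homomorphism : coefficients -Raw-AlmostCommutative⟶ almostCommutativeRing
    homomorphism = record
      { ⟦_⟧    = value
      ; +-homo = λ p q → trans (value≈ (p +ᶜ q))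
                   (trans (difference-+ p q) (sym (+-cong (value≈ p) (value≈ q))))
      ; *-homo = λ p q → trans (value≈ (p *ᶜ q))
                   (trans (difference-* p q) (sym (*-cong (value≈ p) (value≈ q))))
      ; -‿homo = λ { p@(a , b) → trans (value≈ (-ᶜ p))
                   (trans (sym (⁻¹-anti-homo‿- (ι a) (ι b))) (-‿cong (sym (value≈ p)))) }
      ; 0-homo = refl
      ; 1-homo = refl
      }

    difference-≡ : ∀ a b a′ b′ → a ℕ.+ b′ ≡.≡ a′ ℕ.+ b → ι a - ι b ≈ ι a′ - ι b′
    difference-≡ a b a′ b′ eq = begin
      ι a - ι b                          ≈⟨ +-identityʳ _ ⟨
      (ι a - ι b) + 0#                   ≈⟨ +-congˡ (-‿inverseʳ (ι b′)) ⟨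
      (ι a - ι b) + (ι b′ - ι b′)        ≈⟨ +-interchange _ _ _ _ ⟩
      (ι a + ι b′) + (- ι b - ι b′)      ≈⟨ +-cong (×-homo-+ 1# a b′) (+-comm _ _) ⟨
      ι (a ℕ.+ b′) + (- ι b′ - ι b)      ≡⟨ ≡.cong (λ t → ι t + (- ι b′ - ι b)) eq ⟩
      ι (a′ ℕ.+ b) + (- ι b′ - ι b)      ≈⟨ +-congʳ (×-homo-+ 1# a′ b) ⟩
      (ι a′ + ι b) + (- ι b′ - ι b)      ≈⟨ +-interchange _ _ _ _ ⟩
      (ι a′ - ι b′) + (ι b - ι b)        ≈⟨ +-congˡ (-‿inverseʳ (ι b)) ⟩
      (ι a′ - ι b′) + 0#                 ≈⟨ +-identityʳ _ ⟩
      ι a′ - ι b′                        ∎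

    -- Pairs are not normalised: x - x produces the coefficient (1 , 1), which has to be recognised
    -- as zero. Comparing `a + b′` with `a′ + b` decides equality of the integers represented. The
    -- answer `nothing` asserts no inequality, since distinct integers may agree in the ring.
    value≟ : ∀ p q → Maybe (value p ≈ value q)
    value≟ p@(a , b) q@(a′ , b′) with a ℕ.+ b′ ℕ.≟ a′ ℕ.+ b
    ... | yes eq = just (trans (value≈ p)
                     (trans (difference-≡ a b a′ b′ eq) (sym (value≈ q))))
    ... | no _   = nothing

  open RingSolver coefficients almostCommutativeRing homomorphism value≟ public
    using (solve; _:=_; _:+_; _:-_; _:*_; :-_; con; Polynomial)

  :0 :1 : ∀ {n} → Polynomial n
  :0 = con (0 , 0)
  :1 = con (1 , 0)

module Lemmas (F : HeytingField c ℓ₁ ℓ₂) where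

  open FieldOperations F
  open IntegerSolver commutativeRing
  open ExpProperties semiring using (^-congˡ)
  open SetoidReasoning setoid
  private
    module ∑ = SemiringSumProperties semiring
    module ∏ = SumProperties (CommutativeRing.*-commutativeMonoid commutativeRing)

  ι-* : ∀ m k → ι (m ℕ.* k) ≈ ι m * ι k
  ι-* = MultProperties.×1-homo-* semiring

  ι-cong : ∀ {j k} → j ≡.≡ k → ι j ≈ ι k
  ι-cong ≡.refl = refl

  -- Reciprocals.

  inv : ∀ {u} → u # 0# → Carrier
  inv u#0 = proj₁ (#⇒invertible u#0)

  inverseʳ : ∀ {u} (u#0 : u # 0#) → u * inv u#0 ≈ 1#
  inverseʳ {u} u#0 =
    trans (*-congʳ (sym (x-0≈x u))) (proj₂ (proj₂ (#⇒invertible u#0)))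

  -- A reciprocal is extracted from a particular proof of apartness, so reciprocals of equal
  -- elements need not be the same term. Uniqueness is what identifies them, whatever the proofs.
  inverse-unique : ∀ {u v a b} → u ≈ v → u * a ≈ 1# → v * b ≈ 1# → a ≈ b
  inverse-unique {u} {v} {a} {b} u≈v ua≈1 vb≈1 = begin
    a            ≈⟨ *-identityʳ a ⟨
    a * 1#       ≈⟨ *-congˡ vb≈1 ⟨
    a * (v * b)  ≈⟨ *-congˡ (*-congʳ u≈v) ⟨
    a * (u * b)  ≈⟨ solve 3 (λ a u b → a :* (u :* b) := u :* a :* b) refl a u b ⟩
    u * a * b    ≈⟨ *-congʳ ua≈1 ⟩
    1# * b       ≈⟨ *-identityˡ b ⟩
    b            ∎

  *-cancelˡ-# : ∀ {u a b} → u # 0# → u * a ≈ u * b → a ≈ b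
  *-cancelˡ-# {u} {a} {b} u#0 ua≈ub = begin
    a            ≈⟨ expand a ⟩
    w * (u * a)  ≈⟨ *-congˡ ua≈ub ⟩
    w * (u * b)  ≈⟨ expand b ⟨
    b            ∎
    where
    w = inv u#0
    expand : ∀ t → t ≈ w * (u * t)
    expand t = begin
      t            ≈⟨ *-identityˡ t ⟨
      1# * t       ≈⟨ *-congʳ (inverseʳ u#0) ⟨
      u * w * t    ≈⟨ solve 3 (λ u w t → u :* w :* t := w :* (u :* t)) refl u w t ⟩
      w * (u * t)  ∎

  -- Falling factorials.

  falling : Carrier → ℕ → Carrier
  falling u n = product {n} (λ i → u - ι (toℕ i))

  falling-cong : ∀ {u v} n → u ≈ v → falling u n ≈ falling v n
  falling-cong n u≈v = ∏.sum-cong-≋ {n} (λ i → +-congʳ u≈v)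

  falling-suc : ∀ u n → falling u (suc n) ≈ u * falling (u - 1#) n
  falling-suc u n = *-cong (x-0≈x u) (∏.sum-cong-≋ {n} λ i →
    solve 3 (λ u e t → u :- (e :+ t) := u :- e :- t) refl u 1# (ι (toℕ i)))

  falling-+ : ∀ u m n → falling u (m ℕ.+ n) ≈ falling u m * falling (u - ι m) n
  falling-+ u zero    n = begin
    falling u n                ≈⟨ falling-cong n (x-0≈x u) ⟨
    falling (u - 0#) n         ≈⟨ *-identityˡ _ ⟨
    1# * falling (u - 0#) n    ∎
  falling-+ u (suc m) n = begin
    falling u (suc m ℕ.+ n)
      ≈⟨ falling-suc u (m ℕ.+ n) ⟩
    u * falling (u - 1#) (m ℕ.+ n)
      ≈⟨ *-congˡ (falling-+ (u - 1#) m n) ⟩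
    u * (falling (u - 1#) m * falling (u - 1# - ι m) n)
      ≈⟨ *-assoc _ _ _ ⟨
    u * falling (u - 1#) m * falling (u - 1# - ι m) n
      ≈⟨ *-cong (sym (falling-suc u m)) (falling-cong n
           (solve 3 (λ u e t → u :- e :- t := u :- (e :+ t)) refl u 1# (ι m))) ⟩
    falling u (suc m) * falling (u - ι (suc m)) n
      ∎

  falling-sucʳ : ∀ u n → falling u (suc n) ≈ falling u n * (u - ι n)
  falling-sucʳ u n = begin
    falling u (suc n)                    ≡⟨ ≡.cong (falling u) (ℕ.+-comm n 1) ⟨
    falling u (n ℕ.+ 1)                  ≈⟨ falling-+ u n 1 ⟩
    falling u n * ((u - ι n - 0#) * 1#)  ≈⟨ *-congˡ (trans (*-identityʳ _) (x-0≈x _)) ⟩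
    falling u n * (u - ι n)              ∎

  -- The two products list the same factors in opposite orders, so the induction peels the first
  -- factor off the left and the last off the right. This turns the binomials in `x + ι n` and
  -- `w + ι n` into products over the nodes.
  falling≈∏ : ∀ u n → falling (u + ι n) n ≈ product {n} (λ i → u + ι (suc (toℕ i)))
  falling≈∏ u zero    = refl
  falling≈∏ u (suc n) = begin
    falling (u + ι (suc n)) (suc n)
      ≈⟨ falling-suc (u + ι (suc n)) n ⟩
    (u + ι (suc n)) * falling (u + ι (suc n) - 1#) n
      ≈⟨ *-comm _ _ ⟩
    falling (u + ι (suc n) - 1#) n * (u + ι (suc n))
      ≈⟨ *-congʳ (trans (falling-cong n
           (solve 3 (λ u e t → u :+ (e :+ t) :- e := u :+ t) refl u 1# (ι n)))
           (falling≈∏ u n)) ⟩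
    product {n} (λ i → u + ι (suc (toℕ i))) * (u + ι (suc n))
      ≈⟨ *-cong
           (∏.sum-cong-≋ {n} λ i → +-congˡ (+-congˡ (ι-cong (≡.sym (toℕ-inject₁ i)))))
           (+-congˡ (+-congˡ (ι-cong (≡.sym (toℕ-fromℕ n))))) ⟩
    product {n} (λ i → u + ι (suc (toℕ (inject₁ i)))) * (u + ι (suc (toℕ (fromℕ n))))
      ≈⟨ ∏.sum-init-last {n} (λ i → u + ι (suc (toℕ i))) ⟨
    product {suc n} (λ i → u + ι (suc (toℕ i)))
      ∎

  -- Alternating binomial sums as iterated differences.

  -- ∇ m f = ∑ (-1)^k C(m,k) f k
  ∇ : ∀ m → Vector Carrier (suc m) → Carrier
  ∇ zero    f = head f
  ∇ (suc m) f = ∇ m (init f) - ∇ m (tail f)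

  ∇-cong : ∀ m {f g : Vector Carrier (suc m)} → (∀ i → f i ≈ g i) → ∇ m f ≈ ∇ m g
  ∇-cong zero    f≈g = f≈g zero
  ∇-cong (suc m) f≈g =
    +-cong (∇-cong m (f≈g ∘ inject₁)) (-‿cong (∇-cong m (f≈g ∘ suc)))

  ∇-homo-+ : ∀ m (f g : Vector Carrier (suc m)) →
             ∇ m (λ i → f i + g i) ≈ ∇ m f + ∇ m g
  ∇-homo-+ zero    f g = refl
  ∇-homo-+ (suc m) f g = trans
    (+-cong (∇-homo-+ m (init f) (init g)) (-‿cong (∇-homo-+ m (tail f) (tail g))))
    (solve 4 (λ a b c d → a :+ b :- (c :+ d) := a :- c :+ (b :- d)) refl _ _ _ _)

  ∇-homo-*ˡ : ∀ m a (f : Vector Carrier (suc m)) → ∇ m (λ i → a * f i) ≈ a * ∇ m f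
  ∇-homo-*ˡ zero    a f = refl
  ∇-homo-*ˡ (suc m) a f = trans
    (+-cong (∇-homo-*ˡ m a (init f)) (-‿cong (∇-homo-*ˡ m a (tail f))))
    (solve 3 (λ a b c → a :* b :- a :* c := a :* (b :- c)) refl _ _ _)

  ∇-homo-neg : ∀ m (f : Vector Carrier (suc m)) → ∇ m (λ i → - f i) ≈ - ∇ m f
  ∇-homo-neg zero    f = refl
  ∇-homo-neg (suc m) f = trans
    (+-cong (∇-homo-neg m (init f)) (-‿cong (∇-homo-neg m (tail f))))
    (solve 2 (λ b c → :- b :- :- c := :- (b :- c)) refl _ _)

  ∇-homo-- : ∀ m (f g : Vector Carrier (suc m)) →
             ∇ m (λ i → f i - g i) ≈ ∇ m f - ∇ m g
  ∇-homo-- m f g = trans (∇-homo-+ m f (λ i → - g i)) (+-congˡ (∇-homo-neg m g))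

  -- This is k C(m+1,k) = (m+1) C(m,k-1); the sign comes from moving the index by one. Since `∇`
  -- carries no explicit coefficients, it is proved along Pascal's rule, where the weight k+1 on the
  -- tail contributes one extra unweighted sum.
  ∇-absorption : ∀ m (f : Vector Carrier (suc (suc m))) →
                 ∇ (suc m) (λ i → ι (toℕ i) * f i) ≈ - (ι (suc m) * ∇ m (tail f))
  ∇-absorption zero    f =
    solve 2 (λ a b → :0 :* a :- (:1 :+ :0) :* b := :- ((:1 :+ :0) :* b)) refl _ _
  ∇-absorption (suc m) f = begin
    ∇ (suc m) (λ i → ι (toℕ (inject₁ i)) * init f i)
      - ∇ (suc m) (λ i → ι (suc (toℕ i)) * tail f i)
      ≈⟨ +-cong
           (∇-cong (suc m) {g = weighted (init f)} λ i → *-congʳ (ι-cong (toℕ-inject₁ i)))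
           (-‿cong (trans
             (∇-cong (suc m) {g = λ i → tail f i + weighted (tail f) i} λ i → solve 2 (λ k a → (:1 :+ k) :* a := a :+ k :* a)
               refl (ι (toℕ i)) (tail f i))
             (∇-homo-+ (suc m) (tail f) (weighted (tail f))))) ⟩
    ∇ (suc m) (weighted (init f))
      - (∇ (suc m) (tail f) + ∇ (suc m) (weighted (tail f)))
      ≈⟨ +-cong (∇-absorption m (init f))
           (-‿cong (+-congˡ (∇-absorption m (tail f)))) ⟩
    - (n * p) - ((p - q) + - (n * q))
      ≈⟨ solve 3 (λ n p q → :- (n :* p) :- ((p :- q) :+ :- (n :* q))
           := :- ((:1 :+ n) :* (p :- q))) refl n p q ⟩
    - ((1# + n) * (p - q))
      ∎
    where
    n = ι (suc m)
    p = ∇ m (tail (init f))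
    q = ∇ m (tail (tail f))
    weighted : ∀ {n} → Vector Carrier n → Vector Carrier n
    weighted g i = ι (toℕ i) * g i

  -- The partial fraction expansion of R and its derived form.

  -- Instantiated with x k = X + k + 1, y k = Y + k and w k = X - Y + k + 1;
  -- z and v hold the reciprocals of x and w.
  record Nodes (m : ℕ) : Set (c Level.⊔ ℓ₁) where
    field
      x y w z v : Vector Carrier (suc m)
      x-step : ∀ i → x (suc i) ≈ x (inject₁ i) + 1#
      w-step : ∀ i → w (suc i) ≈ w (inject₁ i) + 1#
      -- The index of `x` runs one ahead of that of `y`, so the constant difference is X - Y + 1,
      -- which is the first entry of `w`.
      x≈y+w₀ : ∀ i → x i ≈ y i + head w
      xz≈1   : ∀ i → x i * z i ≈ 1#
      wv≈1   : ∀ i → w i * v i ≈ 1#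

    y-step : ∀ i → y (suc i) ≈ y (inject₁ i) + 1#
    y-step i = begin
      y (suc i)                      ≈⟨ y≈x-w₀ (suc i) ⟩
      x (suc i) - head w             ≈⟨ +-congʳ (x-step i) ⟩
      x (inject₁ i) + 1# - head w    ≈⟨ solve 3 (λ x e w → x :+ e :- w := x :- w :+ e) refl _ _ _ ⟩
      x (inject₁ i) - head w + 1#    ≈⟨ +-congʳ (y≈x-w₀ (inject₁ i)) ⟨
      y (inject₁ i) + 1#             ∎
      where
      y≈x-w₀ : ∀ i → y i ≈ x i - head w
      y≈x-w₀ i = begin
        y i                      ≈⟨ solve 2 (λ y w → y := y :+ w :- w) refl _ _ ⟩
        y i + head w - head w    ≈⟨ +-congʳ (x≈y+w₀ i) ⟨
        x i - head w             ∎

    ratio : Carrier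
    ratio = product (λ i → w i * z i)

    moment : ℕ → Carrier
    moment p = ∇ m (λ i → z i ^ p * falling (y i) (suc m))

  open Nodes

  initNodes : ∀ {m} → Nodes (suc m) → Nodes m
  initNodes N = record
    { x = init (x N); y = init (y N); w = init (w N); z = init (z N); v = init (v N)
    ; x-step = x-step N ∘ inject₁
    ; w-step = w-step N ∘ inject₁
    ; x≈y+w₀ = x≈y+w₀ N ∘ inject₁
    ; xz≈1   = xz≈1 N ∘ inject₁
    ; wv≈1   = wv≈1 N ∘ inject₁
    }

  -- Shifts x and w but not y.
  tailNodes : ∀ {m} → Nodes (suc m) → Nodes m
  tailNodes N = record
    { x = tail (x N); y = init (y N); w = tail (w N); z = tail (z N); v = tail (v N)
    ; x-step = x-step N ∘ suc
    ; w-step = w-step N ∘ suc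
    ; x≈y+w₀ = λ i → begin
        x N (suc i)                           ≈⟨ x-step N i ⟩
        x N (inject₁ i) + 1#                  ≈⟨ +-congʳ (x≈y+w₀ N (inject₁ i)) ⟩
        y N (inject₁ i) + head (w N) + 1#     ≈⟨ +-assoc _ _ _ ⟩
        y N (inject₁ i) + (head (w N) + 1#)   ≈⟨ +-congˡ (w-step N zero) ⟨
        y N (inject₁ i) + w N (suc zero)      ∎
    ; xz≈1   = xz≈1 N ∘ suc
    ; wv≈1   = wv≈1 N ∘ suc
    }

  last-step : ∀ m (a : Vector Carrier (suc m)) →
              (∀ i → a (suc i) ≈ a (inject₁ i) + 1#) → last a ≈ head a + ι m
  last-step zero    a step = sym (+-identityʳ (head a))
  last-step (suc m) a step = begin
    last a                       ≈⟨ last-step m (tail a) (step ∘ suc) ⟩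
    a (suc zero) + ι m           ≈⟨ +-congʳ (step zero) ⟩
    head a + 1# + ι m            ≈⟨ +-assoc _ _ _ ⟩
    head a + (1# + ι m)          ∎

  -- Each factor y - (m+1), respectively y, of the longer falling factorial is
  -- x minus a multiple independent of k, and x cancels one factor of z.
  moment-suc : ∀ {m} (N : Nodes (suc m)) p →
    moment N (suc p)
    ≈ moment (initNodes N) p - moment (tailNodes N) p
      - (last (w N) * moment (initNodes N) (suc p)
         - head (w N) * moment (tailNodes N) (suc p))
  moment-suc {m} N p = begin
    ∇ m (λ i → z N (inject₁ i) ^ suc p * falling (y N (inject₁ i)) (suc (suc m)))
      - ∇ m (λ i → z N (suc i) ^ suc p * falling (y N (suc i)) (suc (suc m)))
      ≈⟨ +-cong (expand (z N ∘ inject₁) (last (w N)) _ init-term)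
                (-‿cong (expand (z N ∘ suc) (head (w N)) _ tail-term)) ⟩
    (a - last (w N) * b) - (a′ - head (w N) * b′)
      ≈⟨ solve 4 (λ a s a′ t → a :- s :- (a′ :- t) := a :- a′ :- (s :- t)) refl _ _ _ _ ⟩
    a - a′ - (last (w N) * b - head (w N) * b′)
      ∎
    where
    a  = moment (initNodes N) p
    a′ = moment (tailNodes N) p
    b  = moment (initNodes N) (suc p)
    b′ = moment (tailNodes N) (suc p)

    φ : Vector Carrier (suc m)
    φ i = falling (y N (inject₁ i)) (suc m)

    cancel : ∀ {x y w z} → x ≈ y + w → x * z ≈ 1# → z * y ≈ 1# - w * z
    cancel {x} {y} {w} {z} x≈y+w xz≈1 = begin
      z * y                ≈⟨ solve 3 (λ y w z → z :* y := (y :+ w) :* z :- w :* z) refl y w z ⟩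
      (y + w) * z - w * z  ≈⟨ +-congʳ (*-congʳ x≈y+w) ⟨
      x * z - w * z        ≈⟨ +-congʳ xz≈1 ⟩
      1# - w * z           ∎

    expand : ∀ (ζ : Vector Carrier (suc m)) ω (ψ : Vector Carrier (suc m)) →
      (∀ i → ζ i * ψ i ≈ (1# - ω * ζ i) * φ i) →
      ∇ m (λ i → ζ i ^ suc p * ψ i)
      ≈ ∇ m (λ i → ζ i ^ p * φ i) - ω * ∇ m (λ i → ζ i ^ suc p * φ i)
    expand ζ ω ψ eq = begin
      ∇ m (λ i → ζ i ^ suc p * ψ i)
        ≈⟨ ∇-cong m {g = λ i → ζ i ^ p * φ i - ω * (ζ i ^ suc p * φ i)} (λ i → begin
             ζ i * ζ i ^ p * ψ i
               ≈⟨ solve 3 (λ z q t → z :* q :* t := q :* (z :* t)) refl (ζ i) (ζ i ^ p) (ψ i) ⟩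
             ζ i ^ p * (ζ i * ψ i)
               ≈⟨ *-congˡ (eq i) ⟩
             ζ i ^ p * ((1# - ω * ζ i) * φ i)
               ≈⟨ solve 4 (λ q w z f → q :* ((:1 :- w :* z) :* f) := q :* f :- w :* (z :* q :* f))
                    refl (ζ i ^ p) ω (ζ i) (φ i) ⟩
             ζ i ^ p * φ i - ω * (ζ i * ζ i ^ p * φ i) ∎) ⟩
      ∇ m (λ i → ζ i ^ p * φ i - ω * (ζ i ^ suc p * φ i))
        ≈⟨ ∇-homo-- m _ _ ⟩
      ∇ m (λ i → ζ i ^ p * φ i) - ∇ m (λ i → ω * (ζ i ^ suc p * φ i))
        ≈⟨ +-congˡ (-‿cong (∇-homo-*ˡ m ω _)) ⟩
      ∇ m (λ i → ζ i ^ p * φ i) - ω * ∇ m (λ i → ζ i ^ suc p * φ i)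
        ∎

    init-term : ∀ i → z N (inject₁ i) * falling (y N (inject₁ i)) (suc (suc m))
                ≈ (1# - last (w N) * z N (inject₁ i)) * φ i
    init-term i = begin
      z′ * falling y′ (suc (suc m))
        ≈⟨ *-congˡ (falling-sucʳ y′ (suc m)) ⟩
      z′ * (φ i * (y′ - ι (suc m)))
        ≈⟨ solve 3 (λ z f t → z :* (f :* t) := z :* t :* f) refl z′ (φ i) (y′ - ι (suc m)) ⟩
      z′ * (y′ - ι (suc m)) * φ i
        ≈⟨ *-congʳ (cancel x≈ (xz≈1 N (inject₁ i))) ⟩
      (1# - last (w N) * z′) * φ i
        ∎
      where
      y′ = y N (inject₁ i)
      z′ = z N (inject₁ i)
      x≈ : x N (inject₁ i) ≈ (y′ - ι (suc m)) + last (w N)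
      x≈ = begin
        x N (inject₁ i)
          ≈⟨ x≈y+w₀ N (inject₁ i) ⟩
        y′ + head (w N)
          ≈⟨ solve 3 (λ y w n → y :+ w := y :- n :+ (w :+ n)) refl y′ (head (w N)) (ι (suc m)) ⟩
        (y′ - ι (suc m)) + (head (w N) + ι (suc m))
          ≈⟨ +-congˡ (last-step (suc m) (w N) (w-step N)) ⟨
        (y′ - ι (suc m)) + last (w N)
          ∎

    tail-term : ∀ i → z N (suc i) * falling (y N (suc i)) (suc (suc m))
                ≈ (1# - head (w N) * z N (suc i)) * φ i
    tail-term i = begin
      z′ * falling y′ (suc (suc m))
        ≈⟨ *-congˡ (falling-suc y′ (suc m)) ⟩
      z′ * (y′ * falling (y′ - 1#) (suc m))
        ≈⟨ *-assoc _ _ _ ⟨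
      z′ * y′ * falling (y′ - 1#) (suc m)
        ≈⟨ *-cong (cancel (x≈y+w₀ N (suc i)) (xz≈1 N (suc i)))
             (falling-cong (suc m) (trans (+-congʳ (y-step N i))
               (solve 2 (λ y e → y :+ e :- e := y) refl _ _))) ⟩
      (1# - head (w N) * z′) * φ i
        ∎
      where
      y′ = y N (suc i)
      z′ = z N (suc i)

  -- Passing from the initial nodes to all of them multiplies the ratio by its last w/x; multiplying
  -- through by the last x clears the denominator. That x is written as `head (x N)` plus m+1 so
  -- that subtracting `ratio-tail` leaves exactly m+1 times the ratio.
  ratio-init : ∀ {m} (N : Nodes (suc m)) →
    last (w N) * ratio (initNodes N) ≈ ratio N * (head (x N) + ι (suc m))
  ratio-init {m} N = begin
    ω * a                                ≈⟨ *-identityʳ _ ⟨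
    ω * a * 1#                           ≈⟨ *-congˡ (xz≈1 N (fromℕ (suc m))) ⟨
    ω * a * (last (x N) * last (z N))    ≈⟨ solve 4 (λ w a x z → w :* a :* (x :* z) := a :* (w :* z) :* x)
                                              refl ω a (last (x N)) (last (z N)) ⟩
    a * (ω * last (z N)) * last (x N)    ≈⟨ *-cong
                                              (sym (∏.sum-init-last (λ i → w N i * z N i)))
                                              (last-step (suc m) (x N) (x-step N)) ⟩
    ratio N * (head (x N) + ι (suc m))   ∎
    where
    ω = last (w N)
    a = ratio (initNodes N)

  ratio-tail : ∀ {m} (N : Nodes (suc m)) →
    head (w N) * ratio (tailNodes N) ≈ ratio N * head (x N)
  ratio-tail N = begin
    ω * a                              ≈⟨ *-identityʳ _ ⟨
    ω * a * 1#                         ≈⟨ *-congˡ (xz≈1 N zero) ⟨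
    ω * a * (head (x N) * head (z N))  ≈⟨ solve 4 (λ w a x z → w :* a :* (x :* z) := w :* z :* a :* x)
                                            refl ω a (head (x N)) (head (z N)) ⟩
    ratio N * head (x N)               ∎
    where
    ω = head (w N)
    a = ratio (tailNodes N)

  -- Partial fractions of R - 1 in X: numerator and denominator of R are monic of the same degree
  -- m+1, whence the -1. At X = -(k+1) the numerator of R is (-1)^(m+1) (Y+k)^{(m+1)}, and the
  -- remaining denominator factors give (-1)^k k! (m-k)!, so the residue is (-1)^(m+1) (-1)^k C(m,k)
  -- (Y+k)^{(m+1)} / m!.
  moment-one : ∀ m (N : Nodes m) →
    moment N 1 ≈ - ((- 1#) ^ m * ι (m !) * (ratio N - 1#))
  moment-one zero N = begin
    z₀ * 1# * ((y₀ - 0#) * 1#)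
      ≈⟨ solve 3 (λ y w z → z :* :1 :* ((y :- :0) :* :1) := (y :+ w) :* z :- w :* z)
           refl y₀ w₀ z₀ ⟩
    (y₀ + w₀) * z₀ - w₀ * z₀
      ≈⟨ +-congʳ (trans (*-congʳ (sym (x≈y+w₀ N zero))) (xz≈1 N zero)) ⟩
    1# - w₀ * z₀
      ≈⟨ solve 2 (λ w z → :1 :- w :* z
           := :- (:1 :* (:1 :+ :0) :* (w :* z :* :1 :- :1))) refl w₀ z₀ ⟩
    - (1# * ι 1 * (w₀ * z₀ * 1# - 1#))
      ∎
    where
    w₀ = w N zero; y₀ = y N zero; z₀ = z N zero
  moment-one (suc m) N = begin
    moment N 1
      ≈⟨ moment-suc N 0 ⟩
    -- Moments of order zero involve only `y`, which the two halves share, so both are the same `b`.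
    b - b - (ω * moment (initNodes N) 1 - w₀ * moment (tailNodes N) 1)
      ≈⟨ +-congˡ (-‿cong (+-cong (*-congˡ (moment-one m (initNodes N)))
           (-‿cong (*-congˡ (moment-one m (tailNodes N)))))) ⟩
    b - b - (ω * - (s * f * (a₁ - 1#)) - w₀ * - (s * f * (a₂ - 1#)))
      ≈⟨ solve 7 (λ b ω w₀ s f a₁ a₂ →
           b :- b :- (ω :* :- (s :* f :* (a₁ :- :1)) :- w₀ :* :- (s :* f :* (a₂ :- :1)))
           := s :* f :* (ω :* a₁ :- w₀ :* a₂ :- (ω :- w₀)))
           refl b ω w₀ s f a₁ a₂ ⟩
    s * f * (ω * a₁ - w₀ * a₂ - (ω - w₀))
      ≈⟨ *-congˡ (+-cong (+-cong (ratio-init N) (-‿cong (ratio-tail N)))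
           (-‿cong (+-congʳ (last-step (suc m) (w N) (w-step N))))) ⟩
    s * f * (a * (x₀ + n) - a * x₀ - (w₀ + n - w₀))
      ≈⟨ solve 6 (λ s f a x₀ n w₀ →
           s :* f :* (a :* (x₀ :+ n) :- a :* x₀ :- (w₀ :+ n :- w₀))
           := :- (:- :1 :* s :* (n :* f) :* (a :- :1)))
           refl s f a x₀ n w₀ ⟩
    - (- 1# * s * (n * f) * (a - 1#))
      ≈⟨ -‿cong (*-congʳ (*-congˡ (ι-* (suc m) (m !)))) ⟨
    - (- 1# * s * ι (suc m !) * (a - 1#))
      ∎
    where
    ω = last (w N); w₀ = head (w N); x₀ = head (x N)
    s = (- 1#) ^ m; f = ι (m !); n = ι (suc m)
    a = ratio N; a₁ = ratio (initNodes N); a₂ = ratio (tailNodes N)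
    b = moment (initNodes N) 0

  -- Minus the derivative of `moment-one` in X with Y fixed: every x and w grows at unit rate, so R′
  -- is R times the sum of all 1/w - 1/x. In the induction the recursion lowers the order by one,
  -- which is where `moment-one` enters.
  moment-two : ∀ m (N : Nodes m) →
    moment N 2 ≈ (- 1#) ^ m * ι (m !) * ratio N * (sum (v N) - sum (z N))
  moment-two zero N = begin
    z₀ * (z₀ * 1#) * ((y₀ - 0#) * 1#)
      ≈⟨ solve 3 (λ y w z → z :* (z :* :1) :* ((y :- :0) :* :1)
           := z :* ((y :+ w) :* z :- w :* z)) refl y₀ w₀ z₀ ⟩
    z₀ * ((y₀ + w₀) * z₀ - w₀ * z₀)
      -- The 1 equal to x z is rewritten as w v, so that w factors out and leaves v - z.
      ≈⟨ *-congˡ (+-congʳ (trans (*-congʳ (sym (x≈y+w₀ N zero)))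
           (trans (xz≈1 N zero) (sym (wv≈1 N zero))))) ⟩
    z₀ * (w₀ * v₀ - w₀ * z₀)
      ≈⟨ solve 3 (λ w z v → z :* (w :* v :- w :* z)
           := :1 :* (:1 :+ :0) :* (w :* z :* :1) :* (v :+ :0 :- (z :+ :0))) refl w₀ z₀ v₀ ⟩
    1# * ι 1 * (w₀ * z₀ * 1#) * (v₀ + 0# - (z₀ + 0#))
      ∎
    where
    w₀ = w N zero; y₀ = y N zero; z₀ = z N zero; v₀ = v N zero
  moment-two (suc m) N = begin
    moment N 2
      ≈⟨ moment-suc N 1 ⟩
    moment (initNodes N) 1 - moment (tailNodes N) 1
      - (ω * moment (initNodes N) 2 - w₀ * moment (tailNodes N) 2)
      ≈⟨ +-cong
           (+-cong (moment-one m (initNodes N)) (-‿cong (moment-one m (tailNodes N))))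
           (-‿cong (+-cong
             (*-congˡ (trans (moment-two m (initNodes N)) (*-congˡ init-sums)))
             (-‿cong (*-congˡ (trans (moment-two m (tailNodes N)) (*-congˡ tail-sums)))))) ⟩
    - (s * f * (a₁ - 1#)) - - (s * f * (a₂ - 1#))
      - (ω * (s * f * a₁ * (d - vₗ + zₗ)) - w₀ * (s * f * a₂ * (d - v₀ + z₀)))
      ≈⟨ solve 11 (λ ω w₀ s f a₁ a₂ d vₗ zₗ v₀ z₀ →
           :- (s :* f :* (a₁ :- :1)) :- :- (s :* f :* (a₂ :- :1))
           :- (ω :* (s :* f :* a₁ :* (d :- vₗ :+ zₗ)) :- w₀ :* (s :* f :* a₂ :* (d :- v₀ :+ z₀)))
           := s :* f :* ((a₂ :- a₁) :- ((ω :* a₁ :- w₀ :* a₂) :* d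
                :- (ω :* vₗ :* a₁ :- w₀ :* v₀ :* a₂) :+ (ω :* a₁ :* zₗ :- w₀ :* a₂ :* z₀))))
           refl ω w₀ s f a₁ a₂ d vₗ zₗ v₀ z₀ ⟩
    s * f * ((a₂ - a₁) - ((ω * a₁ - w₀ * a₂) * d
      - (ω * vₗ * a₁ - w₀ * v₀ * a₂) + (ω * a₁ * zₗ - w₀ * a₂ * z₀)))
      ≈⟨ *-congˡ (+-congˡ (-‿cong (+-cong
           (+-cong (*-congʳ difference) (-‿cong (+-cong
             (*-congʳ (wv≈1 N (fromℕ (suc m)))) (-‿cong (*-congʳ (wv≈1 N zero))))))
           (+-cong last-cancels (-‿cong head-cancels))))) ⟩
    -- The part `a₂ - a₁` left by the moments of order one is cancelled by the reciprocals `vₗ` and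
    -- `v₀` missing from the shorter sums; the missing `zₗ` and `z₀` contribute `a` each, with
    -- opposite signs.
    s * f * ((a₂ - a₁) - (a * n * d - (1# * a₁ - 1# * a₂) + (a - a)))
      ≈⟨ solve 7 (λ s f a a₁ a₂ n d →
           s :* f :* ((a₂ :- a₁) :- (a :* n :* d :- (:1 :* a₁ :- :1 :* a₂) :+ (a :- a)))
           := :- :1 :* s :* (n :* f) :* a :* d) refl s f a a₁ a₂ n d ⟩
    - 1# * s * (n * f) * a * d
      ≈⟨ *-congʳ (*-congʳ (*-congˡ (ι-* (suc m) (m !)))) ⟨
    - 1# * s * ι (suc m !) * a * d
      ∎
    where
    ω = last (w N); w₀ = head (w N); x₀ = head (x N)
    vₗ = last (v N); v₀ = head (v N); zₗ = last (z N); z₀ = head (z N)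
    s = (- 1#) ^ m; f = ι (m !); n = ι (suc m)
    a = ratio N; a₁ = ratio (initNodes N); a₂ = ratio (tailNodes N)
    d = sum (v N) - sum (z N)

    init-sums : sum (init (v N)) - sum (init (z N)) ≈ d - vₗ + zₗ
    init-sums = trans
      (solve 4 (λ p q r t → p :- q := p :+ r :- (q :+ t) :- r :+ t) refl _ _ vₗ zₗ)
      (+-congʳ (+-congʳ (sym (+-cong (∑.sum-init-last (v N))
        (-‿cong (∑.sum-init-last (z N)))))))

    tail-sums : sum (tail (v N)) - sum (tail (z N)) ≈ d - v₀ + z₀
    tail-sums =
      solve 4 (λ p q r t → p :- q := r :+ p :- (t :+ q) :- r :+ t) refl _ _ v₀ z₀

    difference : ω * a₁ - w₀ * a₂ ≈ a * n
    difference = trans (+-cong (ratio-init N) (-‿cong (ratio-tail N)))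
      (solve 3 (λ a x n → a :* (x :+ n) :- a :* x := a :* n) refl a x₀ n)

    last-cancels : ω * a₁ * zₗ ≈ a
    last-cancels = begin
      ω * a₁ * zₗ           ≈⟨ *-congʳ (ratio-init N) ⟩
      a * (x₀ + n) * zₗ     ≈⟨ *-congʳ (*-congˡ (last-step (suc m) (x N) (x-step N))) ⟨
      a * last (x N) * zₗ   ≈⟨ *-assoc _ _ _ ⟩
      a * (last (x N) * zₗ) ≈⟨ *-congˡ (xz≈1 N (fromℕ (suc m))) ⟩
      a * 1#                ≈⟨ *-identityʳ a ⟩
      a                     ∎

    head-cancels : w₀ * a₂ * z₀ ≈ a
    head-cancels = begin
      w₀ * a₂ * z₀    ≈⟨ *-congʳ (ratio-tail N) ⟩
      a * x₀ * z₀     ≈⟨ *-assoc _ _ _ ⟩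
      a * (x₀ * z₀)   ≈⟨ *-congˡ (xz≈1 N zero) ⟩
      a * 1#          ≈⟨ *-identityʳ a ⟩
      a               ∎

  -- Sums of reciprocal powers.

  ∑-homo-- : ∀ {n} (f g : Vector Carrier n) → sum (λ i → f i - g i) ≈ sum f - sum g
  ∑-homo-- {zero}  f g = sym (-‿inverseʳ 0#)
  ∑-homo-- {suc n} f g = trans (+-congˡ (∑-homo-- (tail f) (tail g)))
    (solve 4 (λ a b c d → a :- b :+ (c :- d) := a :+ c :- (b :+ d)) refl _ _ _ _)

  inverse-^ : ∀ ℓ {u z} → u * z ≈ 1# → u ^ ℓ * z ^ ℓ ≈ 1#
  inverse-^ zero    uz≈1 = *-identityʳ 1#
  inverse-^ (suc ℓ) {u} {z} uz≈1 = begin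
    u * u ^ ℓ * (z * z ^ ℓ)
      ≈⟨ solve 4 (λ u p z q → u :* p :* (z :* q) := u :* z :* (p :* q)) refl u _ z _ ⟩
    u * z * (u ^ ℓ * z ^ ℓ)
      ≈⟨ *-cong uz≈1 (inverse-^ ℓ uz≈1) ⟩
    1# * 1#
      ≈⟨ *-identityʳ 1# ⟩
    1#
      ∎

  1/^ : ∀ ℓ {u u′ z} (u^ℓ#0 : u ^ ℓ # 0#) → u ≈ u′ → u′ * z ≈ 1# →
        1# / u ^ ℓ [ u^ℓ#0 ] ≈ z ^ ℓ
  1/^ ℓ u^ℓ#0 u≈u′ u′z≈1 = trans (*-identityˡ _)
    (inverse-unique refl (inverseʳ u^ℓ#0) (inverse-^ ℓ (trans (*-congʳ u≈u′) u′z≈1)))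

  1/-cong : ∀ {u u′} (u#0 : u # 0#) (u′#0 : u′ # 0#) → u ≈ u′ →
            1# / u [ u#0 ] ≈ 1# / u′ [ u′#0 ]
  1/-cong u#0 u′#0 u≈u′ =
    *-congˡ (inverse-unique u≈u′ (inverseʳ u#0) (inverseʳ u′#0))

  -- H⟨ ℓ ⟩ n u, but with arbitrary proofs that the denominators do not vanish.
  ∑1/^ : ∀ ℓ n u → (∀ (i : Fin n) → (u + ι (suc (toℕ i))) ^ ℓ # 0#) → Carrier
  ∑1/^ ℓ n u u#0 = ∑[ i < n ] (1# / (u + ι (suc (toℕ i))) ^ ℓ [ u#0 i ])

  -- The equation `j ≡ k` is there to absorb `toℕ (inject₁ i) ≡ toℕ i`, which holds only
  -- propositionally.
  ∑1/^-suc : ∀ ℓ {j k} → j ≡.≡ k → ∀ u {z} u#0 u#0′ → (u + ι (suc k)) * z ≈ 1# →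
             ∑1/^ ℓ (suc k) u u#0 ≈ ∑1/^ ℓ j u u#0′ + z ^ ℓ
  ∑1/^-suc ℓ {k = k} ≡.refl u u#0 u#0′ uz≈1 = trans (∑.sum-init-last terms) (+-cong
    (∑.sum-cong-≋ {k} λ i → 1/-cong (u#0 (inject₁ i)) (u#0′ i)
      (^-congˡ ℓ (+-congˡ (+-congˡ (ι-cong (toℕ-inject₁ i))))))
    (1/^ ℓ (u#0 (fromℕ k)) (+-congˡ (+-congˡ (ι-cong (toℕ-fromℕ k)))) uz≈1))
    where
    terms : Vector Carrier (suc k)
    terms i = 1# / (u + ι (suc (toℕ i))) ^ ℓ [ u#0 i ]

  ∑1/^≈∑ : ∀ n u u#0 {z : Vector Carrier n} →
           (∀ i → (u + ι (suc (toℕ i))) * z i ≈ 1#) → ∑1/^ 1 n u u#0 ≈ sum z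
  ∑1/^≈∑ n u u#0 uz≈1 = ∑.sum-cong-≋ {n} λ i →
    trans (1/^ 1 (u#0 i) refl (uz≈1 i)) (*-identityʳ _)

  -- Summation by parts.

  module WithCharacteristicZero (char0 : CharacteristicZero) where

    open Binomial char0

    -- With n = m+1, multiplying by n makes the splitting of n y integral: (n-k) C(n,k) and k C(n,k)
    -- are n C(m,k) and n C(m,k-1). The factors y+k and y+k-n extend the falling factorial at its
    -- front and at its end. Characteristic zero then allows n to be cancelled.
    ∇-falling-by-parts : ∀ m y (h : Vector Carrier (suc (suc m))) →
      y * ∇ (suc m) (λ i → falling (y + ι (toℕ i) - 1#) m * h i)
      ≈ ∇ m (λ i → falling (y + ι (toℕ i)) (suc m) * (init h i - tail h i))
    ∇-falling-by-parts m y h = *-cancelˡ-# (char0 (suc m)) (begin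
      n * (y * ∇ (suc m) g)
        ≈⟨ *-congˡ (∇-homo-*ˡ (suc m) y g) ⟨
      n * ∇ (suc m) (λ i → y * g i)
        ≈⟨ ∇-homo-*ˡ (suc m) n (λ i → y * g i) ⟨
      ∇ (suc m) (λ i → n * (y * g i))
        ≈⟨ ∇-cong (suc m) {g = λ i → n * P i + ι (toℕ i) * (R i - P i)} split ⟩
      ∇ (suc m) (λ i → n * P i + ι (toℕ i) * (R i - P i))
        ≈⟨ ∇-homo-+ (suc m) (λ i → n * P i) (λ i → ι (toℕ i) * (R i - P i)) ⟩
      ∇ (suc m) (λ i → n * P i) + ∇ (suc m) (λ i → ι (toℕ i) * (R i - P i))
        ≈⟨ +-cong (∇-homo-*ˡ (suc m) n P)
             (trans (∇-absorption m (λ i → R i - P i))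
               (-‿cong (*-congˡ (∇-homo-- m (tail R) (tail P))))) ⟩
      -- The tails of `P` from Pascal's rule and from absorption cancel; `init P` and `tail R`
      -- remain, with the same falling factorial `φ`.
      n * (∇ m (init P) - ∇ m (tail P)) + - (n * (∇ m (tail R) - ∇ m (tail P)))
        ≈⟨ solve 4 (λ n p q r → n :* (p :- q) :+ :- (n :* (r :- q)) := n :* (p :- r))
             refl n _ _ _ ⟩
      n * (∇ m (init P) - ∇ m (tail R))
        ≈⟨ *-congˡ (∇-homo-- m (init P) (tail R)) ⟨
      n * ∇ m (λ i → init P i - tail R i)
        ≈⟨ *-congˡ (∇-cong m {g = λ i → φ i * (init h i - tail h i)} λ i →
             trans (+-cong (*-congʳ (init-P i)) (-‿cong (*-congʳ (tail-R i))))
               (solve 3 (λ f a b → f :* a :- f :* b := f :* (a :- b)) refl _ _ _)) ⟩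
      n * ∇ m (λ i → φ i * (init h i - tail h i))
        ∎)
      where
      n = ι (suc m)
      Y g P R : Vector Carrier (suc (suc m))
      Y i = y + ι (toℕ i)
      g i = falling (Y i - 1#) m * h i
      P i = falling (Y i) (suc m) * h i
      R i = falling (Y i - 1#) (suc m) * h i

      φ : Vector Carrier (suc m)
      φ i = falling (y + ι (toℕ i)) (suc m)

      -- n y = (n - k) (y + k) + k (y + k - n)
      split : ∀ i → n * (y * g i) ≈ n * P i + ι (toℕ i) * (R i - P i)
      split i = begin
        n * (y * (f * h i))
          ≈⟨ solve 5 (λ k y a f t → (:1 :+ a) :* (y :* (f :* t))
               := (:1 :+ a) :* ((y :+ k) :* f :* t)
                  :+ k :* (f :* (y :+ k :- :1 :- a) :* t :- (y :+ k) :* f :* t))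
               refl k y (ι m) f (h i) ⟩
        n * (Y i * f * h i) + k * (f * (Y i - 1# - ι m) * h i - Y i * f * h i)
          ≈⟨ +-cong (*-congˡ (*-congʳ (falling-suc (Y i) m)))
               (*-congˡ (+-cong (*-congʳ (falling-sucʳ (Y i - 1#) m))
                 (-‿cong (*-congʳ (falling-suc (Y i) m))))) ⟨
        n * P i + k * (R i - P i)
          ∎
        where
        k = ι (toℕ i)
        f = falling (Y i - 1#) m

      init-P : ∀ i → falling (Y (inject₁ i)) (suc m) ≈ φ i
      init-P i = falling-cong (suc m) (+-congˡ (ι-cong (toℕ-inject₁ i)))

      tail-R : ∀ i → falling (Y (suc i) - 1#) (suc m) ≈ φ i
      tail-R i = falling-cong (suc m)
        (solve 3 (λ y e k → y :+ (e :+ k) :- e := y :+ k) refl y 1# (ι (toℕ i)))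

    -- Explicit binomial coefficients.

    k!#0 : ∀ k → ι (k !) # 0#
    k!#0 k = char0 (k !) {{k ℕ.!≢0}}

    inv-k! : ℕ → Carrier
    inv-k! k = inv (k!#0 k)

    inv-k!-suc : ∀ k → ι (suc k) * inv-k! (suc k) ≈ inv-k! k
    inv-k!-suc k = inverse-unique refl (begin
      ι (k !) * (ι (suc k) * i′)  ≈⟨ solve 3 (λ f n i → f :* (n :* i) := n :* f :* i) refl _ _ i′ ⟩
      ι (suc k) * ι (k !) * i′    ≈⟨ *-congʳ (ι-* (suc k) (k !)) ⟨
      ι (suc k !) * i′            ≈⟨ inverseʳ (k!#0 (suc k)) ⟩
      1#                          ∎) (inverseʳ (k!#0 k))
      where i′ = inv-k! (suc k)

    signedBinom : ℕ → ℕ → Carrier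
    signedBinom n k = (- 1#) ^ k * binom (ι n) k

    signedBinom-zero : ∀ n → signedBinom n 0 ≈ 1#
    signedBinom-zero n = begin
      1# * (1# * inv-k! 0)   ≈⟨ solve 1 (λ i → :1 :* (:1 :* i) := (:1 :+ :0) :* i) refl (inv-k! 0) ⟩
      ι 1 * inv-k! 0         ≈⟨ inverseʳ (k!#0 0) ⟩
      1#                     ∎

    signedBinom-suc : ∀ n k →
      signedBinom (suc n) (suc k) ≈ signedBinom n (suc k) - signedBinom n k
    signedBinom-suc n k = begin
      - 1# * s * (falling (ι (suc n)) (suc k) * i′)
        ≈⟨ *-congˡ (*-congʳ (trans (falling-suc (ι (suc n)) k) (*-congˡ
             (falling-cong k (solve 2 (λ e t → e :+ t :- e := t) refl 1# N))))) ⟩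
      - 1# * s * ((1# + N) * p * i′)
        -- Pascal's rule from N + 1 = (N - k) + (k + 1): the first part lengthens the falling
        -- factorial, the second reduces (k+1)! to k!.
        ≈⟨ solve 5 (λ s N p i k → :- :1 :* s :* ((:1 :+ N) :* p :* i)
             := :- :1 :* s :* (p :* (N :- k) :* i) :- s :* (p :* ((:1 :+ k) :* i)))
             refl s N p i′ (ι k) ⟩
      - 1# * s * (p * (N - ι k) * i′) - s * (p * (ι (suc k) * i′))
        ≈⟨ +-cong (*-congˡ (*-congʳ (sym (falling-sucʳ N k))))
             (-‿cong (*-congˡ (*-congˡ (inv-k!-suc k)))) ⟩
      - 1# * s * (falling N (suc k) * i′) - s * (p * inv-k! k)
        ∎
      where
      s = (- 1#) ^ k; N = ι n; p = falling N k; i′ = inv-k! (suc k)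

    signedBinom-n<k : ∀ n → signedBinom n (suc n) ≈ 0#
    signedBinom-n<k n = begin
      - 1# * s * (falling N (suc n) * i′)
        ≈⟨ *-congˡ (*-congʳ (falling-sucʳ N n)) ⟩
      - 1# * s * (falling N n * (N - N) * i′)
        ≈⟨ solve 4 (λ s p N i → :- :1 :* s :* (p :* (N :- N) :* i) := :0) refl s (falling N n) N i′ ⟩
      0#
        ∎
      where
      s = (- 1#) ^ n; N = ι n; i′ = inv-k! (suc n)

    -- The signed coefficients obey the same Pascal recursion as `∇`. This links the difference
    -- calculus to the sum in the theorem.
    ∇≈∑ : ∀ n (f : Vector Carrier (suc n)) →
          ∇ n f ≈ ∑[ i ≤ n ] (signedBinom n (toℕ i) * f i)
    ∇≈∑ zero    f = begin
      f zero                             ≈⟨ *-identityˡ _ ⟨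
      1# * f zero                        ≈⟨ *-congʳ (signedBinom-zero 0) ⟨
      signedBinom 0 0 * f zero           ≈⟨ +-identityʳ _ ⟨
      signedBinom 0 0 * f zero + 0#      ∎
    ∇≈∑ (suc n) f = begin
      ∇ n (init f) - ∇ n (tail f)
        ≈⟨ +-cong (∇≈∑ n (init f)) (-‿cong (∇≈∑ n (tail f))) ⟩
      sum (λ i → signedBinom n (toℕ i) * init f i) - sum shifted
        ≈⟨ +-congʳ (+-identityʳ _) ⟨
      -- The added zero is the term with coefficient C(n,n+1); it extends the unshifted sum to the
      -- full index range, so that its first term can be split off and the rest paired with the
      -- shifted sum.
      sum (λ i → signedBinom n (toℕ i) * init f i) + 0# - sum shifted
        ≈⟨ +-congʳ (+-cong
             (∑.sum-cong-≋ {suc n} λ i →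
               reflexive (≡.cong (λ k → signedBinom n k * init f i) (≡.sym (toℕ-inject₁ i))))
             (sym (trans (*-congʳ (trans
               (reflexive (≡.cong (λ k → signedBinom n k) (toℕ-fromℕ (suc n))))
               (signedBinom-n<k n))) (zeroˡ _)))) ⟩
      sum (init terms) + last terms - sum shifted
        ≈⟨ +-congʳ (∑.sum-init-last terms) ⟨
      head terms + sum (tail terms) - sum shifted
        ≈⟨ +-assoc _ _ _ ⟩
      head terms + (sum (tail terms) - sum shifted)
        ≈⟨ +-cong
             (*-congʳ (trans (signedBinom-zero n) (sym (signedBinom-zero (suc n)))))
             (sym (∑-homo-- (tail terms) shifted)) ⟩
      signedBinom (suc n) 0 * head f + sum (λ i → tail terms i - shifted i)
        ≈⟨ +-congˡ (∑.sum-cong-≋ {suc n} λ i → trans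
             (solve 3 (λ a b t → a :* t :- b :* t := (a :- b) :* t) refl
               (signedBinom n (suc (toℕ i))) (signedBinom n (toℕ i)) (f (suc i)))
             (*-congʳ (sym (signedBinom-suc n (toℕ i))))) ⟩
      sum (λ i → signedBinom (suc n) (toℕ i) * f i)
        ∎
      where
      terms : Vector Carrier (suc (suc n))
      terms i = signedBinom n (toℕ i) * f i

      shifted : Vector Carrier (suc n)
      shifted i = signedBinom n (toℕ i) * tail f i

    -- Both (y+k)^{(k)} y^{(n)} and (y+k)^{(n)} (y+k-n)^{(k)} are (y+k)^{(k+n)}, with n = m+1. So
    -- y^{(n)} clears the quotient of binomials, and y/(y+k) removes the first factor of
    -- (y+k)^{(n)}.
    binom-ratio : ∀ y m k b#0 y+k#0 →
      falling y (suc m)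
        * (binom (y + ι k) k / binom (y - ι (suc m) + ι k) k [ b#0 ]
           * (y / (y + ι k) [ y+k#0 ]))
      ≈ y * falling (y + ι k - 1#) m
    binom-ratio y m k b#0 y+k#0 = begin
      f * (a * i * j * (y * r))
        ≈⟨ solve 6 (λ f a i j y r → f :* (a :* i :* j :* (y :* r)) := a :* f :* (i :* j :* (y :* r)))
             refl f a i j y r ⟩
      a * f * (i * j * (y * r))
        ≈⟨ *-congʳ exchange ⟩
      (y + ι k) * g * b * (i * j * (y * r))
        ≈⟨ solve 7 (λ t g b i j y r → t :* g :* b :* (i :* j :* (y :* r))
             := b :* i :* j :* (t :* r) :* (y :* g)) refl (y + ι k) g b i j y r ⟩
      b * i * j * ((y + ι k) * r) * (y * g)
        ≈⟨ *-congʳ (*-cong (inverseʳ b#0) (inverseʳ y+k#0)) ⟩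
      1# * 1# * (y * g)
        ≈⟨ solve 1 (λ t → :1 :* :1 :* t := t) refl (y * g) ⟩
      y * g
        ∎
      where
      n = suc m
      f = falling y n
      a = falling (y + ι k) k
      b = falling (y - ι n + ι k) k
      g = falling (y + ι k - 1#) m
      i = inv-k! k; j = inv b#0; r = inv y+k#0

      exchange : a * f ≈ (y + ι k) * g * b
      exchange = begin
        a * f
          ≈⟨ *-congˡ (falling-cong n (solve 2 (λ y k → y := y :+ k :- k) refl y (ι k))) ⟩
        a * falling (y + ι k - ι k) n
          ≈⟨ falling-+ (y + ι k) k n ⟨
        falling (y + ι k) (k ℕ.+ n)
          ≡⟨ ≡.cong (falling (y + ι k)) (ℕ.+-comm k n) ⟩
        falling (y + ι k) (n ℕ.+ k)
          ≈⟨ falling-+ (y + ι k) n k ⟩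
        falling (y + ι k) n * falling (y + ι k - ι n) k
          ≈⟨ *-cong (falling-suc (y + ι k) m)
               (falling-cong k (solve 3 (λ y k n → y :+ k :- n := y :- n :+ k) refl y (ι k) (ι n))) ⟩
        (y + ι k) * g * b
          ∎

    -- Both sides multiplied by y^{(n)}.

    n!≈n*pred! : ∀ n .{{_ : NonZero n}} → ι (n !) ≈ ι n * ι (ℕ.pred n !)
    n!≈n*pred! (suc m) = ι-* (suc m) (m !)

    -- Here `w` stands for x - y; the lemmas that rely on this assume `w≈x-y`.
    module Identity (n : ℕ) .{{_ : NonZero n}} (x y w : Carrier)
      (x#0 : ∀ (i : Fin n) → x + ι (suc (toℕ i)) # 0#)
      (w#0 : ∀ (i : Fin n) → w + ι (suc (toℕ i)) # 0#) where

      xs ws zs vs : Vector Carrier n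
      xs i = x + ι (suc (toℕ i))
      ws i = w + ι (suc (toℕ i))
      zs i = inv (x#0 i)
      vs i = inv (w#0 i)

      -- After multiplication by y^{(n)}, both sides are this number times the difference of
      -- harmonic sums. The product is R, and (n-1)! is n! divided by the n in the denominator on
      -- the right.
      constant : Carrier
      constant = (- 1#) ^ n * (ι (ℕ.pred n !) * product (λ i → ws i * zs i))

      module _
        (y+k#0 : ∀ (i : Fin (suc n)) → y + ι (toℕ i) # 0#)
        (b#0 : ∀ (i : Fin (suc n)) → binom (y - ι n + ι (toℕ i)) (toℕ i) # 0#)
        (h : Vector Carrier (suc n)) where

        summand : Vector Carrier (suc n)
        summand i =
          let k = toℕ i
          in (- 1#) ^ k
             * binom (ι n) k
             * (binom (y + ι k) k / binom (y - ι n + ι k) k [ b#0 i ])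
             * (y / (y + ι k) [ y+k#0 i ])
             * h i

      falling*rhs : ∀ d n#0 bxy#0 →
        falling y n
          * ((- 1#) ^ n / ι n [ n#0 ]
             * (binom (w + ι n) n / (binom (x + ι n) n * binom y n) [ bxy#0 ])
             * d)
        ≈ constant * d
      falling*rhs d n#0 bxy#0 = begin
        f * (s * j * (falling (w + ι n) n * i * r) * d)
          ≈⟨ *-congˡ (*-congʳ (*-congˡ (*-congʳ (*-congʳ (falling≈∏ w n))))) ⟩
        f * (s * j * (pw * i * r) * d)
          ≈⟨ solve 7 (λ f s j pw i r d → f :* (s :* j :* (pw :* i :* r) :* d)
               := s :* (j :* pw :* (f :* i :* r) :* d)) refl f s j pw i r d ⟩
        s * (j * pw * (f * i * r) * d)
          ≈⟨ *-congˡ (*-congʳ (*-congˡ fir≈)) ⟩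
        s * (j * pw * (pz * (ι n * ι (ℕ.pred n !))) * d)
          ≈⟨ solve 7 (λ s j pw pz n f d → s :* (j :* pw :* (pz :* (n :* f)) :* d)
               := s :* (n :* j :* (f :* (pw :* pz) :* d))) refl s j pw pz (ι n) (ι (ℕ.pred n !)) d ⟩
        s * (ι n * j * (ι (ℕ.pred n !) * (pw * pz) * d))
          ≈⟨ *-congˡ (*-cong (inverseʳ n#0)
               (*-congʳ (*-congˡ (sym (∏.∑-distrib-+ ws zs))))) ⟩
        s * (1# * (ι (ℕ.pred n !) * product (λ i → ws i * zs i) * d))
          ≈⟨ solve 3 (λ s k d → s :* (:1 :* (k :* d)) := s :* k :* d)
               refl s (ι (ℕ.pred n !) * product (λ i → ws i * zs i)) d ⟩
        constant * d
          ∎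
        where
        f = falling y n; s = (- 1#) ^ n; j = inv n#0
        i = inv-k! n; r = inv bxy#0
        pw = product ws; px = product {n} xs; pz = product zs

        pxpz≈1 : px * pz ≈ 1#
        pxpz≈1 = begin
          px * pz
            ≈⟨ ∏.∑-distrib-+ xs zs ⟨
          product {n} (λ k → xs k * zs k)
            ≈⟨ ∏.sum-cong-≋ {n} (λ k → inverseʳ (x#0 k)) ⟩
          product {n} (λ _ → 1#)
            ≈⟨ ∏.sum-replicate-zero n ⟩
          1#
            ∎

        firi≈pz : f * i * r * i ≈ pz
        firi≈pz = inverse-unique refl (begin
          px * (f * i * r * i)
            ≈⟨ solve 4 (λ px f i r → px :* (f :* i :* r :* i) := px :* i :* (f :* i) :* r)
                 refl px f i r ⟩
          px * i * (f * i) * r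
            ≈⟨ *-congʳ (*-congʳ (*-congʳ (falling≈∏ x n))) ⟨
          binom (x + ι n) n * binom y n * r
            ≈⟨ inverseʳ bxy#0 ⟩
          1#
            ∎) pxpz≈1

        -- The right-hand side has one 1/n! in its numerator and two in its denominator, so a full
        -- n! survives; its factor n is split off to meet `j`.
        fir≈ : f * i * r ≈ pz * (ι n * ι (ℕ.pred n !))
        fir≈ = begin
          f * i * r                       ≈⟨ *-identityʳ _ ⟨
          f * i * r * 1#                  ≈⟨ *-congˡ (inverseʳ (k!#0 n)) ⟨
          f * i * r * (ι (n !) * i)       ≈⟨ solve 3 (λ p q i → p :* (q :* i) := p :* i :* q)
                                               refl (f * i * r) (ι (n !)) i ⟩
          f * i * r * i * ι (n !)         ≈⟨ *-cong firi≈pz (n!≈n*pred! n) ⟩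
          pz * (ι n * ι (ℕ.pred n !))     ∎

    open Identity

    -- The weights `h` enter through h_k - h_{k+1} = -1/(x+k+1)², so the sum by parts is minus the
    -- moment of order two at the nodes built from x, y and w.
    falling*sum : ∀ n .{{_ : NonZero n}} x y w x#0 w#0 y+k#0 b#0 h →
      w ≈ x - y →
      (∀ i → h (suc i) ≈ h (inject₁ i) + zs n x y w x#0 w#0 i ^ 2) →
      falling y n * sum (summand n x y w x#0 w#0 y+k#0 b#0 h)
      ≈ constant n x y w x#0 w#0
        * (sum (vs n x y w x#0 w#0) - sum (zs n x y w x#0 w#0))
    falling*sum (suc m) x y w x#0 w#0 y+k#0 b#0 h w≈x-y h-step = begin
      f * sum summands
        ≈⟨ ∑.*-distribˡ-sum f summands ⟩
      sum (λ i → f * summands i)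
        ≈⟨ ∑.sum-cong-≋ {suc n} falling*summand ⟩
      sum (λ i → signedBinom n (toℕ i) * (y * (falling (y + ι (toℕ i) - 1#) m * h i)))
        ≈⟨ ∇≈∑ n (λ i → y * (falling (y + ι (toℕ i) - 1#) m * h i)) ⟨
      ∇ n (λ i → y * (falling (y + ι (toℕ i) - 1#) m * h i))
        ≈⟨ ∇-homo-*ˡ n y (λ i → falling (y + ι (toℕ i) - 1#) m * h i) ⟩
      y * ∇ n (λ i → falling (y + ι (toℕ i) - 1#) m * h i)
        ≈⟨ ∇-falling-by-parts m y h ⟩
      ∇ m (λ i → falling (y + ι (toℕ i)) n * (init h i - tail h i))
        ≈⟨ ∇-cong m {g = λ i → - moments i} differences ⟩
      ∇ m (λ i → - moments i)
        ≈⟨ ∇-homo-neg m moments ⟩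
      - moment nodes 2
        ≈⟨ -‿cong (moment-two m nodes) ⟩
      - ((- 1#) ^ m * ι (m !) * ratio nodes * d)
        ≈⟨ solve 4 (λ s f a d → :- (s :* f :* a :* d) := :- :1 :* s :* (f :* a) :* d)
             refl ((- 1#) ^ m) (ι (m !)) (ratio nodes) d ⟩
      constant n x y w x#0 w#0 * d
        ∎
      where
      n = suc m
      f = falling y n

      summands : Vector Carrier (suc n)
      summands = summand n x y w x#0 w#0 y+k#0 b#0 h

      nodes : Nodes m
      nodes = record
        { x = λ i → x + ι (suc (toℕ i))
        ; y = λ i → y + ι (toℕ i)
        ; w = λ i → w + ι (suc (toℕ i))
        ; z = λ i → inv (x#0 i)
        ; v = λ i → inv (w#0 i)
        ; x-step = step x
        ; w-step = step w
        ; x≈y+w₀ = λ i → trans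
            (solve 4 (λ x y k e → x :+ (e :+ k) := y :+ k :+ (x :- y :+ (e :+ :0)))
              refl x y (ι (toℕ i)) 1#)
            (+-congˡ (+-congʳ (sym w≈x-y)))
        ; xz≈1   = λ i → inverseʳ (x#0 i)
        ; wv≈1   = λ i → inverseʳ (w#0 i)
        }
        where
        step : ∀ u {l} (i : Fin l) →
               u + ι (suc (suc (toℕ i))) ≈ u + ι (suc (toℕ (inject₁ i))) + 1#
        step u i = trans
          (solve 3 (λ u e k → u :+ (e :+ (e :+ k)) := u :+ (e :+ k) :+ e) refl u 1# (ι (toℕ i)))
          (+-congʳ (+-congˡ (+-congˡ (ι-cong (≡.sym (toℕ-inject₁ i))))))

      d = sum (v nodes) - sum (z nodes)

      moments : Vector Carrier n
      moments i = inv (x#0 i) ^ 2 * falling (y + ι (toℕ i)) n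

      regroup : ∀ s b q r t {a} → f * (q * r) ≈ y * a →
                f * (s * b * q * r * t) ≈ s * b * (y * (a * t))
      regroup s b q r t {a} eq = begin
        f * (s * b * q * r * t)
          ≈⟨ solve 6 (λ f s b q r t → f :* (s :* b :* q :* r :* t)
               := s :* b :* (f :* (q :* r) :* t)) refl f s b q r t ⟩
        s * b * (f * (q * r) * t)
          ≈⟨ *-congˡ (trans (*-congʳ eq) (*-assoc y a t)) ⟩
        s * b * (y * (a * t))
          ∎

      falling*summand : ∀ i → f * summands i
        ≈ signedBinom n (toℕ i) * (y * (falling (y + ι (toℕ i) - 1#) m * h i))
      falling*summand i =
        let k = toℕ i
        in regroup ((- 1#) ^ k) (binom (ι n) k)
             (binom (y + ι k) k / binom (y - ι n + ι k) k [ b#0 i ])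
             (y / (y + ι k) [ y+k#0 i ])
             (h i)
             (binom-ratio y m k (b#0 i) (y+k#0 i))

      telescope : ∀ {φ a b s} → b ≈ a + s → φ * (a - b) ≈ - (s * φ)
      telescope {φ} {a} {b} {s} b≈a+s = trans
        (*-congˡ (+-congˡ (-‿cong b≈a+s)))
        (solve 3 (λ f a b → f :* (a :- (a :+ b)) := :- (b :* f)) refl φ a s)

      differences : ∀ i →
        falling (y + ι (toℕ i)) n * (init h i - tail h i) ≈ - moments i
      differences i =
        telescope {falling (y + ι (toℕ i)) n} {init h i} {tail h i} {inv (x#0 i) ^ 2} (h-step i)

    -- All proofs of apartness are universally quantified, so that applying the
    -- identity never makes the type checker compare two (huge) such proofs.
    identity : ∀ n .{{_ : NonZero n}} x y w → w ≈ x - y →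
      (∀ (i : Fin n) → x + ι (suc (toℕ i)) # 0#) →
      (∀ (i : Fin n) → w + ι (suc (toℕ i)) # 0#) →
      (∀ (i : Fin n) → y - ι (toℕ i) # 0#) →
      (y+k#0 : ∀ (i : Fin (suc n)) → y + ι (toℕ i) # 0#)
      (b#0 : ∀ (i : Fin (suc n)) → binom (y - ι n + ι (toℕ i)) (toℕ i) # 0#)
      (x²#0 : ∀ (i : Fin (suc n)) (j : Fin (toℕ i)) → (x + ι (suc (toℕ j))) ^ 2 # 0#)
      (n#0 : ι n # 0#) (bxy#0 : binom (x + ι n) n * binom y n # 0#) →
      ∀ w¹#0 x¹#0 →
      ∑[ i ≤ n ]
        (let k = toℕ i
         in (- 1#) ^ k
            * binom (ι n) k
            * (binom (y + ι k) k / binom (y - ι n + ι k) k [ b#0 i ])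
            * (y / (y + ι k) [ y+k#0 i ])
            * ∑1/^ 2 k x (x²#0 i))
      ≈ ((- 1#) ^ n / ι n [ n#0 ])
        * (binom (w + ι n) n / (binom (x + ι n) n * binom y n) [ bxy#0 ])
        * (∑1/^ 1 n w w¹#0 - ∑1/^ 1 n x x¹#0)
    identity n x y w w≈x-y x#0 w#0 y-i#0 y+k#0 b#0 x²#0 n#0 bxy#0 w¹#0 x¹#0 =
      -- The cancelled factor is y^{(n)}, apart from zero because each y - i with i < n is.
      *-cancelˡ-# (product#0 {n} _ y-i#0) (begin
        falling y n * sum (summand n x y w x#0 w#0 y+k#0 b#0 h)
          ≈⟨ falling*sum n x y w x#0 w#0 y+k#0 b#0 h w≈x-y h-step ⟩
        constant n x y w x#0 w#0 * (sum (vs n x y w x#0 w#0) - sum (zs n x y w x#0 w#0))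
          ≈⟨ *-congˡ (+-cong
               (∑1/^≈∑ n w w¹#0 (λ i → inverseʳ (w#0 i)))
               (-‿cong (∑1/^≈∑ n x x¹#0 (λ i → inverseʳ (x#0 i))))) ⟨
        constant n x y w x#0 w#0 * d
          ≈⟨ falling*rhs n x y w x#0 w#0 d n#0 bxy#0 ⟨
        falling y n
          * ((- 1#) ^ n / ι n [ n#0 ]
             * (binom (w + ι n) n / (binom (x + ι n) n * binom y n) [ bxy#0 ])
             * d)
          ∎)
      where
      d = ∑1/^ 1 n w w¹#0 - ∑1/^ 1 n x x¹#0

      h : Vector Carrier (suc n)
      h i = ∑1/^ 2 (toℕ i) x (x²#0 i)

      h-step : ∀ i → h (suc i) ≈ h (inject₁ i) + inv (x#0 i) ^ 2
      h-step i = ∑1/^-suc 2 (toℕ-inject₁ i) x (x²#0 (suc i)) (x²#0 (inject₁ i))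
        (inverseʳ (x#0 i))

theorem6 : ∀ {c ℓ₁ ℓ₂} (F : HeytingField c ℓ₁ ℓ₂) →
    let open FieldOperations F in
    (char0 : CharacteristicZero) →
    let open Binomial char0 in
    ∀ (n : ℕ) → .{{_ : NonZero n}} → (x y : Carrier) →
    (x∉ : x ∉[ ℤ.- + n , -1ℤ ]) →
    (x-y∉ : (x - y) ∉[ ℤ.- + n , -1ℤ ]) →
    (y∉ : y ∉[ ℤ.- + n , + n ℤ.- + 1 ]) →
    ∑[ i ≤ n ]
      (let k = toℕ i
           k≤n = toℕ≤pred[n] i
       in (- 1#) ^ k
          * binom (ι n) k
          * (binom (y + ι k) k / binom (y - ι n + ι k) k [ binom[y-n+k,k]#0 y∉ k≤n ])
          * (y / (y + ι k) [ y+k#0 y∉ k≤n ])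
          * H⟨ 2 ⟩ k x (∉-mono k≤n x∉))
    ≈ ((- 1#) ^ n / ι n [ char0 n ])
      * (binom (x - y + ι n) n
          / (binom (x + ι n) n * binom y n)
          [ x#0y#0→xy#0 (binom[u+n,n]#0 x∉) (binom[y,n]#0 y∉) ])
      * (H n (x - y) x-y∉ - H n x x∉)
-- The sums over Fin (suc n) unfold, so their proofs are found by unification
-- only when split into the value at zero and the values at suc i.
theorem6 F char0 n x y x∉ x-y∉ y∉ =
  Lemmas.WithCharacteristicZero.identity F char0 n x y _ (HeytingField.refl F)
    (FieldOperations.u+k#0 F x∉)
    (FieldOperations.u+k#0 F x-y∉)
    (λ i → FieldOperations.Binomial.y-m#0 F char0 y∉ (toℕ<n i))
    (∀-cons _ _) (∀-cons _ _) (∀-cons (λ ()) (λ i → ∀-cons _ _)) _ _ _ _
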